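{- For every GKAT expression $e\in\mathrm{Exp}$, the Thompson coalgebra $\mathcal{X}_e$ and the Thompson automaton $\mathcal{X}_e^\iota$ are well-nested.
   Context: Syntax. Fix disjoint nonempty sets $\Sigma$ (actions) and $T=\{t_1,\dots,t_n\}$ (primitive tests), $T$ finite. Boolean expressions $b,c\in\mathrm{BExp}$ are generated by $0 \mid 1 \mid t\in T \mid b\cdot c \mid b+c \mid \overline{b}$. GKAT expressions $e,f\in\mathrm{Exp}$ are generated by $p\in\Sigma \mid b\in\mathrm{BExp} \mid e\cdot f \mid e+_b f \mid e^{(b)}$. $\equiv_{BA}$ denotes Boolean equivalence, $b\le c$ iff $b+c\equiv_{BA}c$. $\mathrm{At}$ is the finite set of atoms (minimal nonzero elements) of the free Boolean algebra $\mathrm{BExp}/{\equiv_{BA}}$ on $T$. Coalgebras. Let $GX=(2+\Sigma\times X)^{\mathrm{At}}$ with $2=\{0,1\}$. A $G$-coalgebra is a pair $\mathcal{X}=\langle X,\delta^{\mathcal{X}}\rangle$ with $\delta^{\mathcal{X}}:X\to GX$; a $G$-automaton is a $G$-coalgebra with a designated start state (and is well-nested if the underlying coalgebra is). The coproduct $\mathcal{X}+\mathcal{Y}$ has the disjoint union $X+Y$ as states, with structure map $\delta^{\mathcal{X}}+\delta^{\mathcal{Y}}$ acting as $\delta^{\mathcal{X}}$ on $X$ and $\delta^{\mathcal{Y}}$ on $Y$. For $Y\subseteq X$ and $h\in GX$, the uniform continuation $\mathcal{X}[Y,h]=\langle X,\delta[Y,h]\rangle$ is given by $\delta[Y,h](x)(\alpha)=h(\alpha)$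 if $x\in Y$ and $\delta^{\mathcal{X}}(x)(\alpha)=1$, and $\delta^{\mathcal{X}}(x)(\alpha)$ otherwise. Coalgebras are identified up to renaming of states (isomorphism). Well-nested coalgebras are defined inductively: (i) if $\mathcal{X}$ has no transitions, i.e. $\delta^{\mathcal{X}}(x)(\alpha)\in2$ for all $x,\alpha$, then $\mathcal{X}$ is well-nested; (ii) if $\mathcal{X}$ and $\mathcal{Y}$ are well-nested and $h\in G(X+Y)$, then $(\mathcal{X}+\mathcal{Y})[X,h]$ is well-nested. Thompson construction. For each $e\in\mathrm{Exp}$ define a $G$-coalgebra (the Thompson coalgebra) $\mathcal{X}_e=\langle X_e,\delta_e\rangle$ and an initial pseudostate $\iota_e\in GX_e$ by recursion: - $e=b$: $X_b=\emptyset$, $\iota_b(\alpha)=1$ if $\alpha\le b$, else $0$. - $e=p$: $X_p=\{*\}$, $\delta_p(*)(\alpha)=1$ for all $\alpha$, $\iota_p(\alpha)=(p,*)$. - $e=f+_bg$: $X_e=X_f+X_g$, $\delta_e=\delta_f+\delta_g$, $\iota_e(\alpha)=\iota_f(\alpha)$ if $\alpha\le b$, $\iota_g(\alpha)$ if $\alpha\le\overline{b}$. - $e=f\cdot g$: $X_e=X_f+X_g$, $\delta_e=(\delta_f+\delta_g)[X_f,\iota_g]$, $\iota_e(\alpha)=\iota_f(\alpha)$ if $\iota_f(\alpha)\ne1$, $\iota_g(\alpha)$ if $\iota_f(\alpha)=1$. - $e=f^{(b)}$: $X_e=X_f$, $\iota_e(\alpha)=1$ if $\alpha\le\overline{b}$;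 $0$ if $\alpha\le b$ and $\iota_f(\alpha)=1$; $\iota_f(\alpha)$ if $\alpha\le b$ and $\iota_f(\alpha)\ne1$; $\delta_e=\delta_f[X_f,\iota_e]$. The Thompson automaton is $\mathcal{X}_e^\iota=\langle\{\iota\}+X_e,\delta_e^\iota,\iota\rangle$ with $\delta_e^\iota(x)=\delta_e(x)$ for $x\in X_e$ and $\delta_e^\iota(\iota)=\iota_e$. -}

module Defs where

open import Algebra.Lattice.Bundles using (BooleanAlgebra)
open import Algebra.Lattice.Structures using (IsBooleanAlgebra)
import Algebra.Lattice.Properties.BooleanAlgebra as BAProperties
open import Data.Bool.Base using (Bool; true; false; not; if_then_else_)
  renaming (_∧_ to _and_; _∨_ to _or_)
import Data.Bool.Properties as Boolₚ
open import Data.Empty using (⊥)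
open import Data.Fin.Base using (Fin; zero; suc)
open import Data.Fin.Subset.Properties using (anySubset?)
open import Data.Nat.Base using (ℕ; zero; suc)
open import Data.Product.Base using (_×_; _,_; ∃; map₂)
open import Data.Sum.Base as Sum using (_⊎_; inj₁; inj₂)
open import Data.Unit.Base using (⊤; tt)
open import Data.Vec.Base using (Vec; []; _∷_; lookup; tabulate)
open import Data.Vec.Properties using (lookup∘tabulate)
open import Data.Vec.Relation.Binary.Pointwise.Extensional using (ext; Pointwise-≡⇒≡)
open import Function.Base using (_∘_)
open import Function.Bundles using (_↔_; Inverse)
open import Level using (Level; 0ℓ) renaming (suc to lsuc; _⊔_ to _⊔ˡ_)
open import Relation.Binary.PropositionalEquality
  using (_≡_; refl; sym; trans; cong; cong₂)
import Relation.Binary.Reasoning.Setoid as SetoidReasoning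
open import Relation.Nullary using (¬_; Dec; yes; no; does; contradiction)
import Relation.Unary as U
open import Relation.Unary using (Pred)
open import Relation.Unary.Properties using (U?)

infixr 7 _·ᵇ_
infixr 6 _+ᵇ_
infix  8 _ᶜ
infix  4 _≡BA_ _≤ᵇ_

data BExp (n : ℕ) : Set where
  0ᵇ 1ᵇ     : BExp n
  prim      : Fin n → BExp n
  _·ᵇ_ _+ᵇ_ : BExp n → BExp n → BExp n
  _ᶜ        : BExp n → BExp n

-- The least congruence satisfying the Boolean algebra axioms, so that BExp n
-- modulo _≡BA_ is the free Boolean algebra on n generators.

data _≡BA_ {n : ℕ} : BExp n → BExp n → Set where
  ≡-refl  : ∀ {b} → b ≡BA b
  ≡-sym   : ∀ {b c} → b ≡BA c → c ≡BA b
  ≡-trans : ∀ {b c d} → b ≡BA c → c ≡BA d → b ≡BA d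
  +-cong  : ∀ {b b′ c c′} → b ≡BA b′ → c ≡BA c′ → b +ᵇ c ≡BA b′ +ᵇ c′
  ·-cong  : ∀ {b b′ c c′} → b ≡BA b′ → c ≡BA c′ → b ·ᵇ c ≡BA b′ ·ᵇ c′
  ᶜ-cong  : ∀ {b b′} → b ≡BA b′ → b ᶜ ≡BA b′ ᶜ
  +-comm  : ∀ b c → b +ᵇ c ≡BA c +ᵇ b
  ·-comm  : ∀ b c → b ·ᵇ c ≡BA c ·ᵇ b
  +-assoc : ∀ b c d → (b +ᵇ c) +ᵇ d ≡BA b +ᵇ (c +ᵇ d)
  ·-assoc : ∀ b c d → (b ·ᵇ c) ·ᵇ d ≡BA b ·ᵇ (c ·ᵇ d)
  +-absorbs-· : ∀ b c → b +ᵇ (b ·ᵇ c) ≡BA b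
  ·-absorbs-+ : ∀ b c → b ·ᵇ (b +ᵇ c) ≡BA b
  +-distrib-· : ∀ b c d → b +ᵇ (c ·ᵇ d) ≡BA (b +ᵇ c) ·ᵇ (b +ᵇ d)
  ·-distrib-+ : ∀ b c d → b ·ᵇ (c +ᵇ d) ≡BA (b ·ᵇ c) +ᵇ (b ·ᵇ d)
  +-compl : ∀ b → b +ᵇ b ᶜ ≡BA 1ᵇ
  ·-compl : ∀ b → b ·ᵇ b ᶜ ≡BA 0ᵇ

_≤ᵇ_ : ∀ {n} → BExp n → BExp n → Set
b ≤ᵇ c = b +ᵇ c ≡BA c

IsAtom : ∀ {n} → BExp n → Set
IsAtom b = ¬ (b ≡BA 0ᵇ) × (∀ c → c ≤ᵇ b → c ≡BA 0ᵇ ⊎ c ≡BA b)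

-- There are no quotient types, so the set At of atoms is given by one
-- representative per ≡BA-class: a vector of signs α stands for the product of
-- literals ⟦ α ⟧.  The lemmas ⟦⟧-isAtom, ⟦⟧-surjective and ⟦⟧-injective below
-- show that α ↦ ⟦ α ⟧ is a bijection onto the atoms modulo ≡BA.

At : ℕ → Set
At n = Vec Bool n

literal : ∀ {n} → BExp n → Bool → BExp n
literal b true  = b
literal b false = b ᶜ

conj : ∀ {n k} → Vec (BExp n) k → Vec Bool k → BExp n
conj []       []      = 1ᵇ
conj (b ∷ bs) (s ∷ α) = literal b s ·ᵇ conj bs α

⟦_⟧ : ∀ {n} → At n → BExp n
⟦ α ⟧ = conj (tabulate prim) α

-- Auxiliary semantics, used only to decide α ≤ b and to verify the
-- representation of atoms.

eval : ∀ {n} → At n → BExp n → Bool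
eval α 0ᵇ       = false
eval α 1ᵇ       = true
eval α (prim i) = lookup α i
eval α (b ·ᵇ c) = eval α b and eval α c
eval α (b +ᵇ c) = eval α b or eval α c
eval α (b ᶜ)    = not (eval α b)

eval-resp : ∀ {n} (α : At n) {b c} → b ≡BA c → eval α b ≡ eval α c
eval-resp α ≡-refl            = refl
eval-resp α (≡-sym p)         = sym (eval-resp α p)
eval-resp α (≡-trans p q)     = trans (eval-resp α p) (eval-resp α q)
eval-resp α (+-cong p q)      = cong₂ _or_ (eval-resp α p) (eval-resp α q)
eval-resp α (·-cong p q)      = cong₂ _and_ (eval-resp α p) (eval-resp α q)
eval-resp α (ᶜ-cong p)        = cong not (eval-resp α p)
eval-resp α (+-comm b c)      = Boolₚ.∨-comm (eval α b) (eval α c)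
eval-resp α (·-comm b c)      = Boolₚ.∧-comm (eval α b) (eval α c)
eval-resp α (+-assoc b c d)   = Boolₚ.∨-assoc (eval α b) (eval α c) (eval α d)
eval-resp α (·-assoc b c d)   = Boolₚ.∧-assoc (eval α b) (eval α c) (eval α d)
eval-resp α (+-absorbs-· b c) = Boolₚ.∨-abs-∧ (eval α b) (eval α c)
eval-resp α (·-absorbs-+ b c) = Boolₚ.∧-abs-∨ (eval α b) (eval α c)
eval-resp α (+-distrib-· b c d) = Boolₚ.∨-distribˡ-∧ (eval α b) (eval α c) (eval α d)
eval-resp α (·-distrib-+ b c d) = Boolₚ.∧-distribˡ-∨ (eval α b) (eval α c) (eval α d)
eval-resp α (+-compl b)       = Boolₚ.∨-inverseʳ (eval α b)
eval-resp α (·-compl b)       = Boolₚ.∧-inverseʳ (eval α b)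

isBooleanAlgebra : ∀ n → IsBooleanAlgebra (_≡BA_ {n}) _+ᵇ_ _·ᵇ_ _ᶜ 1ᵇ 0ᵇ
isBooleanAlgebra n = record
  { isDistributiveLattice = record
    { isLattice = record
      { isEquivalence = record { refl = ≡-refl ; sym = ≡-sym ; trans = ≡-trans }
      ; ∨-comm = +-comm ; ∨-assoc = +-assoc ; ∨-cong = +-cong
      ; ∧-comm = ·-comm ; ∧-assoc = ·-assoc ; ∧-cong = ·-cong
      ; absorptive = +-absorbs-· , ·-absorbs-+
      }
    ; ∨-distrib-∧ = +-distrib-· , λ b c d → ≡-trans (+-comm (c ·ᵇ d) b)
        (≡-trans (+-distrib-· b c d) (·-cong (+-comm b c) (+-comm b d)))
    ; ∧-distrib-∨ = ·-distrib-+ , λ b c d → ≡-trans (·-comm (c +ᵇ d) b)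
        (≡-trans (·-distrib-+ b c d) (+-cong (·-comm b c) (·-comm b d)))
    }
  ; ∨-complement = (λ b → ≡-trans (+-comm (b ᶜ) b) (+-compl b)) , +-compl
  ; ∧-complement = (λ b → ≡-trans (·-comm (b ᶜ) b) (·-compl b)) , ·-compl
  ; ¬-cong       = ᶜ-cong
  }

freeBA : ℕ → BooleanAlgebra 0ℓ 0ℓ
freeBA n = record { isBooleanAlgebra = isBooleanAlgebra n }

module _ {n : ℕ} where
  open BAProperties (freeBA n)
    using (∧-identityʳ; deMorgan₁; deMorgan₂; ¬-involutive; ¬⊥≈⊤)
  open SetoidReasoning (BooleanAlgebra.setoid (freeBA n))

  ≤ᵇ⇒meet : {b c : BExp n} → b ≤ᵇ c → b ·ᵇ c ≡BA b
  ≤ᵇ⇒meet {b} {c} p = begin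
    b ·ᵇ c          ≈⟨ ·-cong ≡-refl (≡-sym p) ⟩
    b ·ᵇ (b +ᵇ c)   ≈⟨ ·-absorbs-+ b c ⟩
    b               ∎

  meet⇒≤ᵇ : {b c : BExp n} → b ·ᵇ c ≡BA b → b ≤ᵇ c
  meet⇒≤ᵇ {b} {c} p = begin
    b +ᵇ c          ≈⟨ +-cong (≡-trans (≡-sym p) (·-comm b c)) ≡-refl ⟩
    c ·ᵇ b +ᵇ c     ≈⟨ +-comm (c ·ᵇ b) c ⟩
    c +ᵇ c ·ᵇ b     ≈⟨ +-absorbs-· c b ⟩
    c               ∎

  ≤ᵇ-trans : {b c d : BExp n} → b ≤ᵇ c → c ≤ᵇ d → b ≤ᵇ d
  ≤ᵇ-trans {b} {c} {d} p q = begin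
    b +ᵇ d          ≈⟨ +-cong ≡-refl (≡-sym q) ⟩
    b +ᵇ (c +ᵇ d)   ≈⟨ ≡-sym (+-assoc b c d) ⟩
    (b +ᵇ c) +ᵇ d   ≈⟨ +-cong p ≡-refl ⟩
    c +ᵇ d          ≈⟨ q ⟩
    d               ∎

  ≤ᵇ-antisym : {b c : BExp n} → b ≤ᵇ c → c ≤ᵇ b → b ≡BA c
  ≤ᵇ-antisym {b} {c} p q = ≡-trans (≡-sym q) (≡-trans (+-comm c b) p)

  b≤b+c : (b c : BExp n) → b ≤ᵇ b +ᵇ c
  b≤b+c b c = meet⇒≤ᵇ (·-absorbs-+ b c)

  b≤c+b : (b c : BExp n) → b ≤ᵇ c +ᵇ b
  b≤c+b b c = ≡-trans (+-cong ≡-refl (+-comm c b))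
                      (≡-trans (b≤b+c b c) (+-comm b c))

  b·c≤b : (b c : BExp n) → b ·ᵇ c ≤ᵇ b
  b·c≤b b c = ≡-trans (+-comm (b ·ᵇ c) b) (+-absorbs-· b c)

  b·c≤c : (b c : BExp n) → b ·ᵇ c ≤ᵇ c
  b·c≤c b c = ≡-trans (+-cong (·-comm b c) ≡-refl) (b·c≤b c b)

  ·-greatest : {b c d : BExp n} → b ≤ᵇ c → b ≤ᵇ d → b ≤ᵇ c ·ᵇ d
  ·-greatest {b} {c} {d} p q = ≡-trans (+-distrib-· b c d) (·-cong p q)

  ≤ᵇ-respʳ : {b c d : BExp n} → c ≡BA d → b ≤ᵇ c → b ≤ᵇ d
  ≤ᵇ-respʳ p q = ≡-trans (+-cong ≡-refl (≡-sym p)) (≡-trans q p)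

  b≤1 : (b : BExp n) → b ≤ᵇ 1ᵇ
  b≤1 b = meet⇒≤ᵇ (∧-identityʳ b)

  b≤bᶜ⇒b≡0 : {b : BExp n} → b ≤ᵇ b ᶜ → b ≡BA 0ᵇ
  b≤bᶜ⇒b≡0 {b} p = ≡-trans (≡-sym (≤ᵇ⇒meet p)) (·-compl b)

  conj≤literal : ∀ {k} (bs : Vec (BExp n) k) α i →
                 conj bs α ≤ᵇ literal (lookup bs i) (lookup α i)
  conj≤literal (b ∷ bs) (s ∷ α) zero    = b·c≤b (literal b s) (conj bs α)
  conj≤literal (b ∷ bs) (s ∷ α) (suc i) =
    ≤ᵇ-trans (b·c≤c (literal b s) (conj bs α)) (conj≤literal bs α i)

  eval-conj : ∀ {k} (α : At n) (bs : Vec (BExp n) k) β →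
              (∀ i → eval α (lookup bs i) ≡ lookup β i) →
              eval α (conj bs β) ≡ true
  eval-conj α []       []          h = refl
  eval-conj α (b ∷ bs) (true  ∷ β) h
    rewrite h zero = eval-conj α bs β (h ∘ suc)
  eval-conj α (b ∷ bs) (false ∷ β) h
    rewrite h zero = eval-conj α bs β (h ∘ suc)

  eval-⟦⟧ : (α : At n) → eval α ⟦ α ⟧ ≡ true
  eval-⟦⟧ α = eval-conj α (tabulate prim) α
    (λ i → cong (eval α) (lookup∘tabulate prim i))

  ⟦⟧≤literal : (α : At n) (b : BExp n) → ⟦ α ⟧ ≤ᵇ literal b (eval α b)
  ⟦⟧≤literal α 0ᵇ       = ≤ᵇ-respʳ (≡-sym ¬⊥≈⊤) (b≤1 ⟦ α ⟧)
  ⟦⟧≤literal α 1ᵇ       = b≤1 ⟦ α ⟧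
  ⟦⟧≤literal α (prim i) with conj≤literal (tabulate prim) α i
  ... | p rewrite lookup∘tabulate (prim {n}) i = p
  ⟦⟧≤literal α (b ·ᵇ c) with eval α b | eval α c | ⟦⟧≤literal α b | ⟦⟧≤literal α c
  ... | true  | true  | p | q = ·-greatest p q
  ... | true  | false | p | q =
    ≤ᵇ-respʳ (≡-sym (deMorgan₁ b c)) (≤ᵇ-trans q (b≤c+b (c ᶜ) (b ᶜ)))
  ... | false | _     | p | q =
    ≤ᵇ-respʳ (≡-sym (deMorgan₁ b c)) (≤ᵇ-trans p (b≤b+c (b ᶜ) (c ᶜ)))
  ⟦⟧≤literal α (b +ᵇ c) with eval α b | eval α c | ⟦⟧≤literal α b | ⟦⟧≤literal α c
  ... | true  | _     | p | q = ≤ᵇ-trans p (b≤b+c b c)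
  ... | false | true  | p | q = ≤ᵇ-trans q (b≤c+b c b)
  ... | false | false | p | q = ≤ᵇ-respʳ (≡-sym (deMorgan₂ b c)) (·-greatest p q)
  ⟦⟧≤literal α (b ᶜ) with eval α b | ⟦⟧≤literal α b
  ... | true  | p = ≤ᵇ-respʳ (≡-sym (¬-involutive b)) p
  ... | false | p = p

  eval-mono : (α : At n) {b c : BExp n} → b ≤ᵇ c → eval α b ≡ true → eval α c ≡ true
  eval-mono α {b} {c} p e =
    trans (sym (eval-resp α p)) (cong (_or eval α c) e)

  ⟦⟧-isAtom : (α : At n) → IsAtom ⟦ α ⟧
  ⟦⟧-isAtom α = nonzero , minimal
    where
    nonzero : ¬ (⟦ α ⟧ ≡BA 0ᵇ)
    nonzero p with trans (sym (eval-⟦⟧ α)) (eval-resp α p)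
    ... | ()
    minimal : ∀ c → c ≤ᵇ ⟦ α ⟧ → c ≡BA 0ᵇ ⊎ c ≡BA ⟦ α ⟧
    minimal c p with eval α c | ⟦⟧≤literal α c
    ... | true  | q = inj₂ (≤ᵇ-antisym p q)
    ... | false | q = inj₁ (b≤bᶜ⇒b≡0 (≤ᵇ-trans p q))

  conj-cover : ∀ {k} (bs : Vec (BExp n) k) {c d : BExp n} →
               (∀ α → d ·ᵇ conj bs α ≤ᵇ c) → d ≤ᵇ c
  conj-cover [] {c} {d} h =
    ≡-trans (+-cong (≡-sym (∧-identityʳ d)) ≡-refl) (h [])
  conj-cover (b ∷ bs) {c} {d} h = begin
    d +ᵇ c
      ≈⟨ +-cong (≡-sym (∧-identityʳ d)) ≡-refl ⟩
    d ·ᵇ 1ᵇ +ᵇ c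
      ≈⟨ +-cong (·-cong ≡-refl (≡-sym (+-compl b))) ≡-refl ⟩
    d ·ᵇ (b +ᵇ b ᶜ) +ᵇ c
      ≈⟨ +-cong (·-distrib-+ d b (b ᶜ)) ≡-refl ⟩
    (d ·ᵇ b +ᵇ d ·ᵇ b ᶜ) +ᵇ c
      ≈⟨ +-assoc (d ·ᵇ b) (d ·ᵇ b ᶜ) c ⟩
    d ·ᵇ b +ᵇ (d ·ᵇ b ᶜ +ᵇ c)
      ≈⟨ +-cong ≡-refl (half false) ⟩
    d ·ᵇ b +ᵇ c
      ≈⟨ half true ⟩
    c ∎
    where
    half : ∀ s → d ·ᵇ literal b s ≤ᵇ c
    half s = conj-cover bs λ α →
      ≡-trans (+-cong (·-assoc d (literal b s) (conj bs α)) ≡-refl) (h (s ∷ α))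

  ⟦⟧-surjective : (b : BExp n) → IsAtom b → ∃ λ α → ⟦ α ⟧ ≡BA b
  ⟦⟧-surjective b (nonzero , minimal)
    with anySubset? (λ α → eval α b Boolₚ.≟ true)
  ... | no none = contradiction (b≤bᶜ⇒b≡0 (conj-cover (tabulate prim) below)) nonzero
    where
    below : ∀ α → b ·ᵇ ⟦ α ⟧ ≤ᵇ b ᶜ
    below α with eval α b in eq | ⟦⟧≤literal α b
    ... | true  | _ = contradiction (α , eq) none
    ... | false | p = ≤ᵇ-trans (b·c≤c b ⟦ α ⟧) p
  ... | yes (α , e) with ⟦⟧≤literal α b
  ...   | p rewrite e with minimal ⟦ α ⟧ p
  ...     | inj₂ q = α , q
  ...     | inj₁ q with ⟦⟧-isAtom α
  ...       | ≢0 , _ = contradiction q ≢0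

  ⟦⟧-injective : (α β : At n) → ⟦ α ⟧ ≡BA ⟦ β ⟧ → α ≡ β
  ⟦⟧-injective α β p = Pointwise-≡⇒≡ (ext agree)
    where
    eval-literal : ∀ i s → eval β (literal (prim i) s) ≡ true → s ≡ lookup β i
    eval-literal i true  e = sym e
    eval-literal i false e with lookup β i | e
    ... | false | _ = refl
    ... | true  | ()
    agree : ∀ i → lookup α i ≡ lookup β i
    agree i = eval-literal i (lookup α i)
      (eval-mono β (⟦⟧≤literal α (prim i))
        (trans (eval-resp β p) (eval-⟦⟧ β)))

  infix 4 _≤?_

  _≤?_ : (α : At n) (b : BExp n) → Dec (⟦ α ⟧ ≤ᵇ b)
  α ≤? b with eval α b in eq | ⟦⟧≤literal α b
  ... | true  | p = yes p
  ... | false | _ = no λ p → contradiction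
                      (trans (sym (eval-mono α p (eval-⟦⟧ α))) eq) λ ()

  -- The cases α ≤ b and α ≤ b ᶜ are exhaustive and exclusive, so that a
  -- test `does (α ≤? b)` has α ≤ b ᶜ as its else-branch.

  ≰⇒≤ᶜ : (α : At n) (b : BExp n) → ¬ (⟦ α ⟧ ≤ᵇ b) → ⟦ α ⟧ ≤ᵇ b ᶜ
  ≰⇒≤ᶜ α b ≰ with eval α b | ⟦⟧≤literal α b
  ... | true  | p = contradiction p ≰
  ... | false | p = p

  ≤⇒≰ᶜ : (α : At n) (b : BExp n) → ⟦ α ⟧ ≤ᵇ b → ¬ (⟦ α ⟧ ≤ᵇ b ᶜ)
  ≤⇒≰ᶜ α b p q with trans (sym (eval-mono α q (eval-⟦⟧ α)))
                          (cong not (eval-mono α p (eval-⟦⟧ α)))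
  ... | ()

-- f +[ b ] g is "if b then f else g" and f ^⟨ b ⟩ is "while b do f".

data Exp {a} (Action : Set a) (n : ℕ) : Set a where
  act     : Action → Exp Action n
  test    : BExp n → Exp Action n
  _·_     : Exp Action n → Exp Action n → Exp Action n
  _+[_]_  : Exp Action n → BExp n → Exp Action n → Exp Action n
  _^⟨_⟩   : Exp Action n → BExp n → Exp Action n

-- 2 + Σ × X, with 2 = Bool.

Out : ∀ {a} → Set a → Set → Set a
Out Action X = Bool ⊎ (Action × X)

pattern reject   = inj₁ false
pattern accept   = inj₁ true
pattern step p x = inj₂ (p , x)

mapOut : ∀ {a} {Action : Set a} {X Y : Set} → (X → Y) → Out Action X → Out Action Y
mapOut f = Sum.map₂ (map₂ f)

G : ∀ {a} → Set a → ℕ → Set → Set a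
G Action n X = At n → Out Action X

mapG : ∀ {a} {Action : Set a} {n : ℕ} {X Y : Set} → (X → Y) → G Action n X → G Action n Y
mapG f h α = mapOut f (h α)

record Coalgebra {a} (Action : Set a) (n : ℕ) : Set (lsuc 0ℓ ⊔ˡ a) where
  constructor ⟨_,_⟩
  field
    State : Set
    δ     : State → G Action n State

open Coalgebra public

record Automaton {a} (Action : Set a) (n : ℕ) : Set (lsuc 0ℓ ⊔ˡ a) where
  field
    coalgebra : Coalgebra Action n
    start     : State coalgebra

infixr 6 _⊕_

_⊕_ : ∀ {a} {Action : Set a} {n : ℕ} →
      Coalgebra Action n → Coalgebra Action n → Coalgebra Action n
𝒳 ⊕ 𝒴 = ⟨ State 𝒳 ⊎ State 𝒴
         , Sum.[ (λ x → mapG inj₁ (δ 𝒳 x)) , (λ y → mapG inj₂ (δ 𝒴 y)) ] ⟩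

-- o ▷ o′ is o′ if o = 1, and o otherwise.

_▷_ : ∀ {a} {Action : Set a} {X : Set} → Out Action X → Out Action X → Out Action X
accept   ▷ o′ = o′
reject   ▷ o′ = reject
step p x ▷ o′ = step p x

-- Uniform continuation 𝒳[Y,h].  The case distinction on x ∈ Y makes
-- decidability of Y part of the data.

_[_,_] : ∀ {a} {Action : Set a} {n : ℕ} (𝒳 : Coalgebra Action n) →
         {Y : Pred (State 𝒳) 0ℓ} → U.Decidable Y →
         G Action n (State 𝒳) → Coalgebra Action n
𝒳 [ Y? , h ] = ⟨ State 𝒳
               , (λ x α → if does (Y? x) then δ 𝒳 x α ▷ h α else δ 𝒳 x α) ⟩

Left : {X Y : Set} → Pred (X ⊎ Y) 0ℓ
Left (inj₁ _) = ⊤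
Left (inj₂ _) = ⊥

left? : {X Y : Set} → U.Decidable (Left {X} {Y})
left? (inj₁ _) = yes tt
left? (inj₂ _) = no λ ()

record _≅_ {a} {Action : Set a} {n : ℕ} (𝒳 𝒴 : Coalgebra Action n) : Set a where
  field
    bijection : State 𝒳 ↔ State 𝒴
    homo      : ∀ x α → δ 𝒴 (Inverse.to bijection x) α
                        ≡ mapOut (Inverse.to bijection) (δ 𝒳 x α)

-- The constructor `rename` expresses that coalgebras are identified up to
-- isomorphism.

data WellNested {a} {Action : Set a} {n : ℕ} : Coalgebra Action n → Set (lsuc 0ℓ ⊔ˡ a) where
  discrete : ∀ {𝒳} → (∀ x α → ∃ λ o → δ 𝒳 x α ≡ inj₁ o) → WellNested 𝒳
  compose  : ∀ {𝒳 𝒴} → WellNested 𝒳 → WellNested 𝒴 →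
             (h : G Action n (State 𝒳 ⊎ State 𝒴)) →
             WellNested ((𝒳 ⊕ 𝒴) [ left? , h ])
  rename   : ∀ {𝒳 𝒴} → 𝒳 ≅ 𝒴 → WellNested 𝒳 → WellNested 𝒴

WellNestedAutomaton : ∀ {a} {Action : Set a} {n : ℕ} →
                      Automaton Action n → Set (lsuc 0ℓ ⊔ˡ a)
WellNestedAutomaton A = WellNested (Automaton.coalgebra A)

-- Initial pseudostate of f ^⟨ b ⟩, given that of f.

loop : ∀ {a} {Action : Set a} {n : ℕ} {X : Set} → BExp n → G Action n X → G Action n X
loop b h α = if does (α ≤? b) then h α ▷ reject else accept

thompson : ∀ {a} {Action : Set a} {n : ℕ} → Exp Action n → Coalgebra Action n
ι : ∀ {a} {Action : Set a} {n : ℕ} (e : Exp Action n) → G Action n (State (thompson e))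

thompson (act p)      = ⟨ ⊤ , (λ _ _ → accept) ⟩
thompson (test b)     = ⟨ ⊥ , (λ ()) ⟩
thompson (f · g)      = (thompson f ⊕ thompson g) [ left? , mapG inj₂ (ι g) ]
thompson (f +[ b ] g) = thompson f ⊕ thompson g
thompson (f ^⟨ b ⟩)   = thompson f [ U? , loop b (ι f) ]

ι (act p)      α = step p tt
ι (test b)     α = if does (α ≤? b) then accept else reject
ι (f · g)      α = mapG inj₁ (ι f) α ▷ mapG inj₂ (ι g) α
ι (f +[ b ] g) α = if does (α ≤? b) then mapG inj₁ (ι f) α else mapG inj₂ (ι g) α
ι (f ^⟨ b ⟩)     = loop b (ι f)

thompsonAutomaton : ∀ {a} {Action : Set a} {n : ℕ} → Exp Action n → Automaton Action n
thompsonAutomaton e = record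
  { coalgebra = ⟨ ⊤ ⊎ State (thompson e)
                , Sum.[ (λ _ → mapG inj₂ (ι e)) , (λ x → mapG inj₂ (δ (thompson e) x)) ] ⟩
  ; start     = inj₁ tt
  }

{-# OPTIONS --safe #-}
module Submission where

-- Every step of the Thompson construction is, up to renaming of states, an
-- instance of (𝒳 + 𝒴)[X,h]: the choice f +_b g takes h constantly 1, which
-- continues nothing; the loop takes 𝒴 empty, so that X is the whole state
-- space; and the automaton takes for 𝒳 a single accepting state, which h = ι_e
-- turns into the start state.

open import Defs
open import Data.Bool.Base using (true)
import Data.Empty.Polymorphic as Polymorphic
open import Data.Nat.Base using (ℕ; NonZero)
open import Data.Product.Base using (_×_; _,_)
open import Data.Sum.Algebra using (⊎-identityʳ)
open import Data.Sum.Base using (inj₁; inj₂)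
open import Data.Unit.Base using (⊤)
open import Function.Base using (_∘_; id)
open import Function.Bundles using (Inverse)
open import Function.Construct.Identity using (↔-id)
open import Level using (0ℓ)
open import Relation.Binary.PropositionalEquality
  using (_≡_; refl; sym; trans; cong₂)
open import Relation.Unary.Properties using (U?)

module _ {a} {Action : Set a} where

  mapOut-id : {X : Set} (o : Out Action X) → mapOut id o ≡ o
  mapOut-id (inj₁ _) = refl
  mapOut-id (inj₂ _) = refl

  mapOut-∘ : {X Y Z : Set} (f : Y → Z) (g : X → Y) (o : Out Action X) →
             mapOut f (mapOut g o) ≡ mapOut (f ∘ g) o
  mapOut-∘ f g (inj₁ _) = refl
  mapOut-∘ f g (inj₂ _) = refl

  -- `▷` branches on the kind of its left argument, and renaming states never changes that kind.
  mapOut-▷ : {X Y : Set} (f : X → Y) (o o′ : Out Action X) →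
             mapOut f (o ▷ o′) ≡ mapOut f o ▷ mapOut f o′
  mapOut-▷ f accept     o′ = refl
  mapOut-▷ f reject     o′ = refl
  mapOut-▷ f (step _ _) o′ = refl

  ▷-identityʳ : {X : Set} (o : Out Action X) → o ▷ accept ≡ o
  ▷-identityʳ accept     = refl
  ▷-identityʳ reject     = refl
  ▷-identityʳ (step _ _) = refl

  module _ {n : ℕ} where

    -- Pointwise agreement of structure maps gives an isomorphism whose renaming is the identity.
    WellNested-resp-≗ : {X : Set} {γ δ : X → G Action n X} →
                        (∀ x α → δ x α ≡ γ x α) →
                        WellNested ⟨ X , γ ⟩ → WellNested ⟨ X , δ ⟩
    WellNested-resp-≗ {X} {γ} δ≗γ = rename record
      { bijection = ↔-id X
      ; homo      = λ x α → trans (δ≗γ x α) (sym (mapOut-id (γ x α)))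
      }

    ⊕-wellNested : {𝒳 𝒴 : Coalgebra Action n} →
                   WellNested 𝒳 → WellNested 𝒴 → WellNested (𝒳 ⊕ 𝒴)
    ⊕-wellNested {𝒳} 𝒳-wn 𝒴-wn =
      WellNested-resp-≗ agree (compose 𝒳-wn 𝒴-wn (λ _ → accept))
      where
      agree : ∀ z α → _
      -- `compose` has turned each output `o` on the left into `o ▷ accept`.
      agree (inj₁ x) α = sym (▷-identityʳ (mapOut inj₁ (δ 𝒳 x α)))
      agree (inj₂ y) α = refl

    [U,]-wellNested : {𝒳 : Coalgebra Action n} → WellNested 𝒳 →
                      (h : G Action n (State 𝒳)) → WellNested (𝒳 [ U? , h ])
    [U,]-wellNested {𝒳} 𝒳-wn h =
      rename record { bijection = bijection ; homo = homo }
             (compose 𝒳-wn empty-wn (mapG inj₁ h))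
      where
      empty : Coalgebra Action n
      -- The empty type is the one for which `⊎-identityʳ` is stated.
      empty = ⟨ Polymorphic.⊥ , (λ ()) ⟩

      empty-wn : WellNested empty
      empty-wn = discrete λ ()

      bijection = ⊎-identityʳ 0ℓ (State 𝒳)
      to        = Inverse.to bijection

      to-inj₁ : (o : Out Action (State 𝒳)) → mapOut to (mapOut inj₁ o) ≡ o
      -- `to ∘ inj₁` reduces to `id`.
      to-inj₁ o = trans (mapOut-∘ to inj₁ o) (mapOut-id o)

      homo : ∀ z α → δ (𝒳 [ U? , h ]) (to z) α
                     ≡ mapOut to (δ ((𝒳 ⊕ empty) [ left? , mapG inj₁ h ]) z α)
      -- An `inj₂` state would lie in the empty type, so this is the only case. Both `U?` and
      -- `left?` answer yes here, which leaves two instances of `▷` to compare along `to`.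
      homo (inj₁ x) α = sym (trans
        (mapOut-▷ to (mapOut inj₁ (δ 𝒳 x α)) (mapOut inj₁ (h α)))
        (cong₂ _▷_ (to-inj₁ (δ 𝒳 x α)) (to-inj₁ (h α))))

    thompson-wellNested : (e : Exp Action n) → WellNested (thompson e)
    thompson-wellNested (act p)      = discrete λ _ _ → true , refl
    thompson-wellNested (test b)     = discrete λ ()
    thompson-wellNested (f · g)      =
      -- Sequential composition is by definition a uniform continuation of the left summand, so no
      -- renaming intervenes.
      compose (thompson-wellNested f) (thompson-wellNested g) (mapG inj₂ (ι g))
    thompson-wellNested (f +[ b ] g) =
      ⊕-wellNested (thompson-wellNested f) (thompson-wellNested g)
    thompson-wellNested (f ^⟨ b ⟩)   =
      [U,]-wellNested (thompson-wellNested f) (loop b (ι f))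

    thompsonAutomaton-wellNested : (e : Exp Action n) →
                                   WellNestedAutomaton (thompsonAutomaton e)
    thompsonAutomaton-wellNested e =
      -- The two structure maps coincide by computation, but only once the state is known to be
      -- `inj₁` or `inj₂`; hence the case split in `agree`.
      WellNested-resp-≗ agree
        (compose point-wn (thompson-wellNested e) (mapG inj₂ (ι e)))
      where
      point-wn : WellNested ⟨ ⊤ , (λ _ _ → accept) ⟩
      point-wn = discrete λ _ _ → true , refl

      agree : ∀ z α → _
      agree (inj₁ _) α = refl
      agree (inj₂ _) α = refl

theorem4p9 : ∀ {a} (Action : Set a) → Action → (n : ℕ) .{{_ : NonZero n}} →
    (e : Exp Action n) →
    WellNested (thompson e) × WellNestedAutomaton (thompsonAutomaton e)
theorem4p9 Action _ n e = thompson-wellNested e , thompsonAutomaton-wellNested e
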